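{- Let $\mathcal{G}=(G,\lambda)$ be a temporal graph. The following assertions are equivalent: (i) $\mathcal{G}$ admits a TTO (temporal transitive orientation); (ii) $\mathcal{G}$ admits an ATTO (almost temporal transitive orientation); (iii) $\mathrm{Ness}(\mathcal{G})$, the set of necessary arcs of $\mathcal{G}$, induces an acyclic digraph (i.e. the digraph on the vertex set of $G$ with arc set $\mathrm{Ness}(\mathcal{G})$ has no directed cycle, directed 2-cycles included).
   Context: A (simple) temporal graph $\mathcal{G}=(G,\lambda)$ consists of a finite simple undirected graph $G=(V,E)$ and a function $\lambda:E\to\mathbb{N}$ (time-labels). Let $AP(G)=\{(u,v): uv\in E\}$ be the set of all possible arcs, both directions of each edge. For $O\subseteq AP(G)$ let $O^R=\{(v,u):(u,v)\in O\}$. A partial orientation is a set $O\subseteq AP(G)$ with $O\cap O^R=\emptyset$; an orientation is a partial orientation with $O\cup O^R=AP(G)$. An orientation $O$ of $\mathcal{G}$ is a temporal transitive orientation (TTO) if whenever $(a,b)\in O$ and $(b,c)\in O$ with $\lambda(ab)\le\lambda(bc)$, then $(a,c)\in O$ and $\lambda(ac)\ge\lambda(bc)$. The implication digraph $\mathrm{Imp}(\mathcal{G})$ has vertex set $AP(G)$ and, for all distinct vertices $a,b,c$ with $ab,bc\in E$, $\lambda(ab)\le\lambda(bc)$ and ($ac\notin E$ or $\lambda(ac)<\lambda(bc)$), an arc from $(a,b)$ to $(c,b)$ and an arc from $(b,c)$ to $(b,a)$. A quadruple of distinct vertices $(a,b,c,d)$ forms a correlated monolabel triangle if there is $t\in\mathbb{N}$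 such that $ab,bc,ac\in E$ with $\lambda(ab)=\lambda(bc)=\lambda(ac)=t$; $bd\in E$ with $\lambda(bd)\le t$; $cd\in E$ with $\lambda(cd)>t$; and if $ad\in E$ then $\lambda(ad)<t$. The augmented implication digraph $\mathrm{Aug}(\mathcal{G})$ is obtained from $\mathrm{Imp}(\mathcal{G})$ by adding, for every correlated monolabel triangle $(a,b,c,d)$, the arcs $((b,c),(a,c))$ and $((c,a),(c,b))$. An arc $(x,y)\in AP(G)$ forces $(u,v)\in AP(G)$ if there is a directed path (possibly of length $0$) from $(x,y)$ to $(u,v)$ in $\mathrm{Aug}(\mathcal{G})$. For $O\subseteq AP(G)$, $O^+$ is the set of elements of $AP(G)$ forced by some arc of $O$. An orientation $O$ of $\mathcal{G}$ is an ATTO if $O^+=O$. An arc $(x,y)\in AP(G)$ is necessary if $(y,x)$ forces $(x,y)$; $\mathrm{Ness}(\mathcal{G})$ is the set of necessary arcs. -}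

module Defs where

open import Data.Fin.Base using (Fin)
open import Data.List.Base using (List; _∷_; _∷ʳ_)
open import Data.List.Relation.Unary.Linked using (Linked)
open import Data.List.Relation.Unary.Unique.Propositional using (Unique)
open import Data.Nat.Base using (ℕ; _≤_; _<_; _≥_)
open import Data.Product.Base using (Σ-syntax; ∃; ∃₂; _×_; _,_; swap)
open import Data.Sum.Base using (_⊎_)
open import Level using (0ℓ)
open import Relation.Binary.Core using (Rel)
open import Relation.Binary.Construct.Closure.ReflexiveTransitive using (Star)
open import Relation.Binary.Definitions using (Decidable; Irreflexive; Symmetric)
open import Relation.Binary.PropositionalEquality.Core using (_≡_; _≢_)
open import Relation.Nullary.Negation.Core using (¬_)
open import Relation.Unary using (Pred; _∈_; _⊆_; _∩_; _∪_; _≐_; Empty)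

-- The irrelevant argument of `label` and `label-sym` together make `label`
-- a function of the undirected edge alone.
record TemporalGraph (n : ℕ) : Set₁ where
  field
    Edge      : Rel (Fin n) 0ℓ
    edge?     : Decidable Edge
    sym       : Symmetric Edge
    irrefl    : Irreflexive _≡_ Edge
    label     : ∀ u v → .(Edge u v) → ℕ
    label-sym : ∀ u v (uv : Edge u v) → label u v uv ≡ label v u (sym uv)

-- Directed cycles visit pairwise distinct vertices; length 1 (a loop) and
-- length 2 are allowed.
DirectedCycle : ∀ {V : Set} → Rel V 0ℓ → Set
DirectedCycle {V} D =
  ∃₂ λ (v : V) (vs : List V) → Unique (v ∷ vs) × Linked D ((v ∷ vs) ∷ʳ v)

Acyclic : ∀ {V : Set} → Rel V 0ℓ → Set
Acyclic D = ¬ DirectedCycle D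

module _ {n : ℕ} (𝒢 : TemporalGraph n) where
  open TemporalGraph 𝒢

  V : Set
  V = Fin n

  Arc : Set
  Arc = V × V

  ArcSet : Set₁
  ArcSet = Pred Arc 0ℓ

  AP : ArcSet
  AP (u , v) = Edge u v

  infix 9 _ᴿ

  _ᴿ : ArcSet → ArcSet
  (O ᴿ) p = swap p ∈ O

  IsPartialOrientation : ArcSet → Set
  IsPartialOrientation O = O ⊆ AP × Empty (O ∩ O ᴿ)

  IsOrientation : ArcSet → Set
  IsOrientation O = IsPartialOrientation O × (O ∪ O ᴿ) ≐ AP

  IsTTO : ArcSet → Set
  IsTTO O = IsOrientation O ×
    (∀ {a b c} (ab : Edge a b) (bc : Edge b c) →
      (a , b) ∈ O → (b , c) ∈ O → label a b ab ≤ label b c bc →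
      Σ[ ac ∈ Edge a c ] (a , c) ∈ O × label a c ac ≥ label b c bc)

  record ImpTriple (a b c : V) : Set where
    field
      a≢b   : a ≢ b
      b≢c   : b ≢ c
      a≢c   : a ≢ c
      ab    : Edge a b
      bc    : Edge b c
      ab≤bc : label a b ab ≤ label b c bc
      ac    : ¬ Edge a c ⊎ (Σ[ ac ∈ Edge a c ] label a c ac < label b c bc)

  data Imp : Rel Arc 0ℓ where
    head : ∀ {a b c} → ImpTriple a b c → Imp (a , b) (c , b)
    tail : ∀ {a b c} → ImpTriple a b c → Imp (b , c) (b , a)

  record CorrelatedMonolabelTriangle (a b c d : V) : Set where
    field
      a≢b  : a ≢ b
      a≢c  : a ≢ c
      a≢d  : a ≢ d
      b≢c  : b ≢ c
      b≢d  : b ≢ d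
      c≢d  : c ≢ d
      t    : ℕ
      ab   : Edge a b
      bc   : Edge b c
      ac   : Edge a c
      ab≡t : label a b ab ≡ t
      bc≡t : label b c bc ≡ t
      ac≡t : label a c ac ≡ t
      bd   : Edge b d
      bd≤t : label b d bd ≤ t
      cd   : Edge c d
      t<cd : t < label c d cd
      ad<t : (ad : Edge a d) → label a d ad < t

  data Aug : Rel Arc 0ℓ where
    imp  : ∀ {p q} → Imp p q → Aug p q
    cmt₁ : ∀ {a b c d} → CorrelatedMonolabelTriangle a b c d →
           Aug (b , c) (a , c)
    cmt₂ : ∀ {a b c d} → CorrelatedMonolabelTriangle a b c d →
           Aug (c , a) (c , b)

  -- Arcs of Aug join members of AP, so only the endpoints of a path (which
  -- may have length 0) need to be required to lie in AP.
  Forces : Rel Arc 0ℓ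
  Forces p q = p ∈ AP × q ∈ AP × Star Aug p q

  infix 9 _⁺

  _⁺ : ArcSet → ArcSet
  (O ⁺) q = ∃ λ p → p ∈ O × Forces p q

  IsATTO : ArcSet → Set
  IsATTO O = IsOrientation O × O ⁺ ≐ O

  Ness : ArcSet
  Ness p = p ∈ AP × Forces (swap p) p

  AdmitsTTO : Set₁
  AdmitsTTO = ∃ λ O → IsTTO O

  AdmitsATTO : Set₁
  AdmitsATTO = ∃ λ O → IsATTO O

  NessAcyclic : Set
  NessAcyclic = Acyclic {V} λ u v → (u , v) ∈ Ness

-- Both (ii) and (iii) say at least that no arc and its reverse are both
-- necessary, so it is enough to build a TTO from this consistency and to show
-- that a TTO is acyclic and closed under forcing.
--
-- A total orientation O closed under forcing fails to be a TTO only through a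
-- directed triangle with three equal labels.  The key fact (`pull-back`) is
-- that such a triangle u → v → w → u can be transported backwards along
-- forcing: if (x , y) ∈ O forces (u , v), then x → y → w → x is another one,
-- with the same apex w.  In particular none of its arcs is necessary.
--
-- Now orient the edges greedily, in lexicographic order of the pairs (x , y),
-- always adding everything that is forced.  Then each non-necessary arc
-- (w , u) is forced by some (x , y) ∈ O with x ≤ u.  Applied to the arc
-- (w , u) of a bad triangle u → v → w → u with u least possible, transport
-- gives a bad triangle x → y → v → x; so x = u, contradicting u → v.
module Submission where

open import Data.Empty using (⊥; ⊥-elim)
open import Data.Fin.Base using (Fin; toℕ; fromℕ<)
open import Data.Fin.Properties using (any?; _≟_; toℕ-injective; toℕ<n; toℕ-fromℕ<)
open import Data.List.Base using (List; []; _∷_; _∷ʳ_; allFin; cartesianProduct)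
open import Data.List.Membership.Propositional using () renaming (_∈_ to _∈ˡ_)
open import Data.List.Membership.Propositional.Properties using (∈-allFin; ∈-cartesianProduct⁺)
open import Data.List.Relation.Unary.All using ([]; _∷_)
open import Data.List.Relation.Unary.AllPairs using ([]; _∷_)
open import Data.List.Relation.Unary.Any using (here; there)
open import Data.List.Relation.Unary.Linked using (Linked; [-]; _∷_)
open import Data.Nat.Base using (ℕ; zero; suc; _≤_; _<_; s≤s⁻¹)
open import Data.Nat.Induction using (<-wellFounded)
import Data.Nat.Properties as ℕ
open import Data.Product.Base using (Σ-syntax; ∃; ∃₂; _×_; _,_; proj₁; proj₂; swap)
open import Data.Product.Properties using (≡-dec)
open import Data.Sum.Base using (_⊎_; inj₁; inj₂; [_,_]′)
import Data.Sum.Base as Sum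
open import Function.Base using (_∘_; id)
open import Function.Bundles using (_⇔_; mk⇔)
open import Induction.WellFounded using (Acc; acc)
open import Level using (0ℓ)
open import Relation.Binary.Core using (Rel)
open import Relation.Binary.Definitions using (Decidable; DecidableEquality; tri<; tri≈; tri>)
open import Relation.Binary.Construct.Closure.ReflexiveTransitive using (Star; ε; _◅_; _◅◅_)
open import Relation.Binary.PropositionalEquality using (_≡_; _≢_; refl; sym; trans; subst)
open import Relation.Nullary using (¬_; Dec; yes; no)
open import Relation.Nullary.Decidable using (map′; _×-dec_; _⊎-dec_)
import Relation.Unary as U
open import Relation.Unary using (_∈_; _∉_; _⊆_; _∪_)
open import Defs

-- Decidability of reachability in a finite digraph

module Reachability {A : Set} {T : Rel A 0ℓ} where

  -- Warshall: paths all of whose inner vertices lie in the list.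
  Via : List A → Rel A 0ℓ
  Via []       x y = x ≡ y ⊎ T x y
  Via (v ∷ vs) x y = Via vs x y ⊎ (Via vs x v × Via vs v y)

  via? : DecidableEquality A → Decidable T → ∀ vs → Decidable (Via vs)
  via? _≟ᴬ_ T? []       x y = (x ≟ᴬ y) ⊎-dec T? x y
  via? _≟ᴬ_ T? (v ∷ vs) x y =
    via? _≟ᴬ_ T? vs x y ⊎-dec (via? _≟ᴬ_ T? vs x v ×-dec via? _≟ᴬ_ T? vs v y)

  via-base : ∀ vs {x y} → x ≡ y ⊎ T x y → Via vs x y
  via-base []       = id
  via-base (v ∷ vs) = inj₁ ∘ via-base vs

  -- Concatenation at `v` creates no new kind of inner vertex, since `v` is listed already. If both
  -- halves pass through the same head vertex, the closed walk between the two visits is cut out.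
  via-trans : ∀ vs {x v y} → v ∈ˡ vs → Via vs x v → Via vs v y → Via vs x y
  via-trans (v ∷ vs) (here refl) p q =
    inj₂ ([ id , proj₁ ]′ p , [ id , proj₂ ]′ q)
  via-trans (h ∷ vs) (there i) (inj₁ p)       (inj₁ q)       = inj₁ (via-trans vs i p q)
  via-trans (h ∷ vs) (there i) (inj₁ p)       (inj₂ (q , r)) = inj₂ (via-trans vs i p q , r)
  via-trans (h ∷ vs) (there i) (inj₂ (p , q)) (inj₁ r)       = inj₂ (p , via-trans vs i q r)
  via-trans (h ∷ vs) (there i) (inj₂ (p , _)) (inj₂ (_ , r)) = inj₂ (p , r)

  via⇒star : ∀ vs {x y} → Via vs x y → Star T x y
  via⇒star []       (inj₁ refl)    = ε
  via⇒star []       (inj₂ t)       = t ◅ ε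
  via⇒star (v ∷ vs) (inj₁ p)       = via⇒star vs p
  via⇒star (v ∷ vs) (inj₂ (p , q)) = via⇒star vs p ◅◅ via⇒star vs q

  star⇒via : ∀ vs → (∀ x → x ∈ˡ vs) → ∀ {x y} → Star T x y → Via vs x y
  star⇒via vs all ε       = via-base vs (inj₁ refl)
  star⇒via vs all (t ◅ p) =
    via-trans vs (all _) (via-base vs (inj₂ t)) (star⇒via vs all p)

  star? : DecidableEquality A → Decidable T → ∀ vs → (∀ x → x ∈ˡ vs) → Decidable (Star T)
  star? _≟ᴬ_ T? vs all x y = map′ (via⇒star vs) (star⇒via vs all) (via? _≟ᴬ_ T? vs x y)

module _ {n : ℕ} (𝒢 : TemporalGraph n) where
  open TemporalGraph 𝒢 renaming (sym to flip)

  private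
    variable
      a b c d u v w x y z : Fin n
      i j k t : ℕ
      p q : Fin n × Fin n

  -- Labels, and the implication triples expressed through them

  Lab : Fin n → Fin n → ℕ → Set
  Lab u v k = Σ[ e ∈ Edge u v ] label u v e ≡ k

  -- Vacuous for non-edges.
  Below : Fin n → Fin n → ℕ → Set
  Below u v k = (e : Edge u v) → label u v e < k

  data Position (u v : Fin n) (k : ℕ) : Set where
    below : Below u v k → Position u v k
    same  : Lab u v k → Position u v k
    above : Lab u v j → k < j → Position u v k

  position : ∀ u v k → Position u v k
  position u v k with edge? u v
  ... | no ¬e = below (λ e → ⊥-elim (¬e e))
  ... | yes e with ℕ.<-cmp (label u v e) k
  ...   | tri< l _ _ = below (λ _ → l)
  ...   | tri≈ _ l _ = same (e , l)
  ...   | tri> _ _ l = above (e , refl) l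

  lab-sym : Lab u v k → Lab v u k
  lab-sym (e , l) = flip e , trans (sym (label-sym _ _ e)) l

  below-sym : Below u v k → Below v u k
  below-sym b e = subst (_< _) (sym (label-sym _ _ e)) (b (flip e))

  below-weaken : j ≤ k → Below u v j → Below u v k
  below-weaken j≤k b e = ℕ.<-≤-trans (b e) j≤k

  lab-below : Lab u v j → j < k → Below u v k
  lab-below (_ , l) j<k _ = subst (_< _) (sym l) j<k

  lab-unique : Lab u v j → Lab u v k → j ≡ k
  lab-unique (_ , l) (_ , m) = trans (sym l) m

  edge-≢ : Edge u v → u ≢ v
  edge-≢ e u≡v = irrefl u≡v e

  cmt : Lab a b t → Lab b c t → Lab a c t → Lab b d i → i ≤ t → Lab c d j → t < j →
        Below a d t → CorrelatedMonolabelTriangle 𝒢 a b c d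
  cmt {t = t} ab@(ab′ , ab≡) (bc , bc≡) ac@(ac′ , ac≡) (bd , refl) bd≤ cd@(cd′ , refl) t< ad = record
    { a≢b = edge-≢ ab′ ; a≢c = edge-≢ ac′
    -- If a = d, then cd is the edge ca, whose label is t and not larger.
    ; a≢d = λ { refl → ℕ.<-irrefl (lab-unique ac (lab-sym cd)) t< }
    ; b≢c = edge-≢ bc ; b≢d = edge-≢ bd ; c≢d = edge-≢ cd′
    ; t = t ; ab = ab′ ; bc = bc ; ac = ac′ ; ab≡t = ab≡ ; bc≡t = bc≡ ; ac≡t = ac≡
    ; bd = bd ; bd≤t = bd≤ ; cd = cd′ ; t<cd = t< ; ad<t = ad }

  impTriple : Lab a b i → Lab b c j → i ≤ j → Below a c j → a ≢ c → ImpTriple 𝒢 a b c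
  impTriple {a} {c = c} (ab , refl) (bc , refl) i≤j ac a≢c = record
    { a≢b = edge-≢ ab ; b≢c = edge-≢ bc ; a≢c = a≢c ; ab = ab ; bc = bc ; ab≤bc = i≤j
    ; ac = case (edge? a c) }
    where
    case : Dec (Edge a c) → _
    case (yes e) = inj₂ (e , ac e)
    case (no ¬e) = inj₁ ¬e

  impTriple-below : ImpTriple 𝒢 a b c → ∃₂ λ i j → Lab a b i × Lab b c j × i ≤ j × Below a c j
  impTriple-below record { ab = ab ; bc = bc ; ab≤bc = l ; ac = ac } =
    _ , _ , (ab , refl) , (bc , refl) , l , [ (λ ¬e e → ⊥-elim (¬e e)) , (λ { (_ , m) _ → m }) ]′ ac

  cmt-labs : CorrelatedMonolabelTriangle 𝒢 a b c d → ∃ λ t → ∃₂ λ i j →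
    Lab a b t × Lab b c t × Lab a c t × Lab b d i × i ≤ t × Lab c d j × t < j × Below a d t
  cmt-labs record { ab = ab ; bc = bc ; ac = ac ; ab≡t = ab≡ ; bc≡t = bc≡ ; ac≡t = ac≡
                  ; bd = bd ; bd≤t = bd≤ ; cd = cd ; t<cd = t< ; ad<t = ad } =
    _ , _ , _ , (ab , ab≡) , (bc , bc≡) , (ac , ac≡) , (bd , refl) , bd≤ , (cd , refl) , t< , ad

  -- Skew-symmetry and endpoints of forcing paths

  swap-aug : Aug 𝒢 p q → Aug 𝒢 (swap q) (swap p)
  swap-aug (imp (head T)) = imp (tail T)
  swap-aug (imp (tail T)) = imp (head T)
  swap-aug (cmt₁ T)       = cmt₂ T
  swap-aug (cmt₂ T)       = cmt₁ T

  swap-star : Star (Aug 𝒢) p q → Star (Aug 𝒢) (swap q) (swap p)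
  swap-star ε       = ε
  swap-star (s ◅ r) = swap-star r ◅◅ (swap-aug s ◅ ε)

  aug-target : Aug 𝒢 p q → q ∈ AP 𝒢
  aug-target (imp (head record { bc = bc })) = flip bc
  aug-target (imp (tail record { ab = ab })) = flip ab
  aug-target (cmt₁ record { ac = ac })       = ac
  aug-target (cmt₂ record { bc = bc })       = flip bc

  star-target : p ∈ AP 𝒢 → Star (Aug 𝒢) p q → q ∈ AP 𝒢
  star-target e ε       = e
  star-target _ (s ◅ r) = star-target (aug-target s) r

  aug-shared : Aug 𝒢 p q → proj₁ p ≡ proj₁ q ⊎ proj₂ p ≡ proj₂ q
  aug-shared (imp (head _)) = inj₂ refl
  aug-shared (imp (tail _)) = inj₁ refl
  aug-shared (cmt₁ _)       = inj₂ refl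
  aug-shared (cmt₂ _)       = inj₁ refl


  -- Decidability of forcing

  impTriple? : ∀ a b c → Dec (ImpTriple 𝒢 a b c)
  impTriple? a b c with edge? a b | edge? b c | a ≟ c
  ... | no ¬ab | _      | _       = no (λ { record { ab = ab } → ¬ab ab })
  ... | yes _  | no ¬bc | _       = no (λ { record { bc = bc } → ¬bc bc })
  ... | yes _  | yes _  | yes a≡c = no (λ { record { a≢c = a≢c } → a≢c a≡c })
  ... | yes ab | yes bc | no a≢c with label a b ab ℕ.≤? label b c bc | position a c (label b c bc)
  ...   | no  ¬l | _         = no (λ { record { ab≤bc = l } → ¬l l })
  ...   | yes l  | below ac  = yes (impTriple (ab , refl) (bc , refl) l ac a≢c)
  ...   | yes l  | same (e , m) = no (λ { record { ac = ac } →
            [ (λ ¬e → ¬e e) , (λ { (_ , l) → ℕ.<-irrefl m l }) ]′ ac })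
  ...   | yes l  | above (e , refl) m = no (λ { record { ac = ac } →
            [ (λ ¬e → ¬e e) , (λ { (_ , l) → ℕ.<-asym m l }) ]′ ac })

  cmt? : ∀ a b c d → Dec (CorrelatedMonolabelTriangle 𝒢 a b c d)
  cmt? a b c d with edge? a b | edge? b c | edge? a c | edge? b d | edge? c d
  ... | no ¬e | _ | _ | _ | _ = no (λ { record { ab = e } → ¬e e })
  ... | yes _ | no ¬e | _ | _ | _ = no (λ { record { bc = e } → ¬e e })
  ... | yes _ | yes _ | no ¬e | _ | _ = no (λ { record { ac = e } → ¬e e })
  ... | yes _ | yes _ | yes _ | no ¬e | _ = no (λ { record { bd = e } → ¬e e })
  ... | yes _ | yes _ | yes _ | yes _ | no ¬e = no (λ { record { cd = e } → ¬e e })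
  ... | yes ab | yes bc | yes ac | yes bd | yes cd =
    map′ (λ { (l , m , o , r , s) → cmt (ab , refl) (bc , l) (ac , m) (bd , refl) o (cd , refl) r s })
         (λ { record { ab≡t = refl ; bc≡t = l ; ac≡t = m ; bd≤t = o ; t<cd = r ; ad<t = s } →
              l , m , o , r , s })
         ((label b c bc ℕ.≟ label a b ab) ×-dec (label a c ac ℕ.≟ label a b ab)
           ×-dec (label b d bd ℕ.≤? label a b ab) ×-dec (label a b ab ℕ.<? label c d cd)
           ×-dec below? (position a d (label a b ab)))
    where
    below? : Position u v k → Dec (Below u v k)
    below? (below l)       = yes l
    below? (same (e , m))  = no (λ l → ℕ.<-irrefl m (l e))
    below? (above (e , refl) m) = no (λ l → ℕ.<-asym m (l e))

  aug? : Decidable (Aug 𝒢)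
  aug? (u , v) (x , y) = map′ to from
    ((v ≟ y ×-dec (impTriple? u v x ⊎-dec any? (cmt? x u v)))
      ⊎-dec (u ≟ x ×-dec (impTriple? y u v ⊎-dec any? (cmt? v y u))))
    where
    to : _ → Aug 𝒢 (u , v) (x , y)
    to (inj₁ (refl , inj₁ T))       = imp (head T)
    to (inj₁ (refl , inj₂ (_ , T))) = cmt₁ T
    to (inj₂ (refl , inj₁ T))       = imp (tail T)
    to (inj₂ (refl , inj₂ (_ , T))) = cmt₂ T
    from : Aug 𝒢 (u , v) (x , y) → _
    from (imp (head T)) = inj₁ (refl , inj₁ T)
    from (cmt₁ T)       = inj₁ (refl , inj₂ (_ , T))
    from (imp (tail T)) = inj₂ (refl , inj₁ T)
    from (cmt₂ T)       = inj₂ (refl , inj₂ (_ , T))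

  aug-star? : Decidable (Star (Aug 𝒢))
  aug-star? = Reachability.star? (≡-dec _≟_ _≟_) aug? (cartesianProduct (allFin n) (allFin n))
    (λ { (u , v) → ∈-cartesianProduct⁺ (∈-allFin u) (∈-allFin v) })

  -- Closed arc sets and their cyclic monolabel triangles

  record Closed (O : ArcSet 𝒢) : Set where
    field
      ⊆AP  : O ⊆ AP 𝒢
      asym : (u , v) ∈ O → (v , u) ∉ O
      step : Aug 𝒢 p q → p ∈ O → q ∈ O

    steps : Star (Aug 𝒢) p q → p ∈ O → q ∈ O
    steps ε       o = o
    steps (s ◅ r) o = steps r (step s o)

  Total : ArcSet 𝒢 → Set
  Total O = ∀ {u v} → Edge u v → (u , v) ∈ O ⊎ (v , u) ∈ O

  module _ {O : ArcSet 𝒢} (closed : Closed O) where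
    open Closed closed

    -- For a = c the premise is the conclusion, so no distinctness is needed.
    head-rule : Lab a b i → Lab b c j → i ≤ j → Below a c j → (a , b) ∈ O → (c , b) ∈ O
    head-rule {a} {c = c} ab bc l ac o with a ≟ c
    ... | yes refl = o
    ... | no a≢c   = step (imp (head (impTriple ab bc l ac a≢c))) o

    tail-rule : Lab a b i → Lab b c j → i ≤ j → Below a c j → (b , c) ∈ O → (b , a) ∈ O
    tail-rule {a} {c = c} ab bc l ac o with a ≟ c
    ... | yes refl = o
    ... | no a≢c   = step (imp (tail (impTriple ab bc l ac a≢c))) o

    -- A consequence of `Imp` alone: by way of d, forcing runs through (a , c), (d , c), (d , b), (a
    -- , b).
    cmt-rule : CorrelatedMonolabelTriangle 𝒢 a b c d → (a , c) ∈ O → (a , b) ∈ O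
    cmt-rule T with cmt-labs T
    ... | _ , _ , _ , ab , bc , ac , bd , bd≤ , cd , t<cd , ad =
      head-rule (lab-sym bd) (lab-sym ab) bd≤ (below-sym ad)
      ∘ tail-rule bd (lab-sym cd) (ℕ.≤-trans bd≤ (ℕ.<⇒≤ t<cd)) (lab-below bc t<cd)
      ∘ head-rule ac cd (ℕ.<⇒≤ t<cd) (below-weaken (ℕ.<⇒≤ t<cd) ad)

    record Cyclic (u v w : Fin n) : Set where
      constructor cyclic
      field
        {time} : ℕ
        uv  : Lab u v time
        vw  : Lab v w time
        wu  : Lab w u time
        u→v : (u , v) ∈ O
        v→w : (v , w) ∈ O
        w→u : (w , u) ∈ O

    rotate : Cyclic u v w → Cyclic w u v
    rotate (cyclic uv vw wu o₁ o₂ o₃) = cyclic wu uv vw o₃ o₁ o₂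

    -- The edge ax is too late: (b , a) forces (x , a), while (c , x) forces (a , x).
    no-above : Lab b a t → Lab a c t → (b , a) ∈ O → (c , x) ∈ O →
               Lab c x i → Lab a x j → i ≤ j → Below b x j → t < j → ⊥
    no-above ba ac b→a c→x cx ax i≤j bx t<j =
      asym (head-rule ba ax (ℕ.<⇒≤ t<j) bx b→a)
           (head-rule cx (lab-sym ax) i≤j (lab-below (lab-sym ac) t<j) c→x)

    -- The cases compare the label of the edge from the apex a to the vertex that the step replaces
    -- b or c with. A label too low or too high makes O contain both directions of some edge; an
    -- equal label lets the new edge take over the place of the old one.
    pull-step : Aug 𝒢 p (c , b) → p ∈ O → Cyclic c b a → Cyclic (proj₁ p) (proj₂ p) a
    pull-step {c = c} {b} {a} (imp (tail {c = x} T)) c→x C@(cyclic {t} cb ba ac c→b b→a a→c)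
      with impTriple-below T
    ... | _ , s , bc , cx , l , bx with lab-unique bc (lab-sym cb) | position a x s
    ...   | refl | below ax   = ⊥-elim (asym a→c (tail-rule ac cx l ax c→x))
    ...   | refl | above ax m = ⊥-elim
              (no-above ba ac b→a c→x cx ax (ℕ.<⇒≤ m) (below-weaken (ℕ.<⇒≤ m) bx) (ℕ.≤-<-trans l m))
    ...   | refl | same ax with ℕ.m≤n⇒m<n∨m≡n l
    ...     | inj₁ m    = ⊥-elim (no-above ba ac b→a c→x cx ax ℕ.≤-refl bx m)
    ...     | inj₂ refl = cyclic cx (lab-sym ax) ac c→x (head-rule ba ax ℕ.≤-refl bx b→a) a→c
    pull-step {c = c} {b} {a} (imp (head {a = x} T)) x→b (cyclic {t} cb ba ac c→b b→a a→c)
      with impTriple-below T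
    ... | _ , _ , xb , bc , l , xc with lab-unique bc (lab-sym cb) | position x a t
    ...   | refl | below xa   = ⊥-elim (asym b→a (head-rule xb ba l xa x→b))
    -- Here (c , b , a , x) is a correlated monolabel triangle, so it is an arc added in `Aug` that
    -- reverses a → c.
    ...   | refl | above xa m = ⊥-elim (asym a→c
              (step (cmt₁ (cmt cb ba (lab-sym ac) (lab-sym xb) l (lab-sym xa) m (below-sym xc))) b→a))
    ...   | refl | same xa with ℕ.m≤n⇒m<n∨m≡n l
    ...     | inj₁ m    = ⊥-elim (asym (tail-rule xa ac ℕ.≤-refl xc a→c)
                            (head-rule ba (lab-sym xa) ℕ.≤-refl (lab-below (lab-sym xb) m) b→a))
    ...     | inj₂ refl = cyclic xb ba (lab-sym xa) x→b b→a (tail-rule xa ac ℕ.≤-refl xc a→c)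
    -- For the augmenting arcs the fourth vertex d is compared with the apex as well. If ad is at
    -- most t or missing, d correlates a triangle at a that reverses an arc of O. If ad is later
    -- than t, d correlates the triangle formed by the apex and the two vertices other than c, which
    -- supplies the new arc x → a.
    pull-step {c = c} {b} {a} (cmt₂ {a = x} {d = d} T) c→x (cyclic {t} cb ba ac c→b b→a a→c)
      with cmt-labs T
    ... | _ , _ , _ , xb , bc , xc , bd , bd≤ , cd , t<cd , xd
      with lab-unique bc (lab-sym cb) | position a x t | position a d t
    ... | refl | below ax   | _ = ⊥-elim (asym a→c (tail-rule ac (lab-sym xc) ℕ.≤-refl ax c→x))
    ... | refl | above ax m | _ = ⊥-elim
            (no-above ba ac b→a c→x (lab-sym xc) ax (ℕ.<⇒≤ m) (lab-below (lab-sym xb) m) m)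
    ... | refl | same ax | below ad = ⊥-elim (asym b→a
            (cmt-rule (cmt (lab-sym ba) bc ac bd bd≤ cd t<cd ad) a→c))
    ... | refl | same ax | same ad = ⊥-elim (asym c→x
            (step (cmt₁ (cmt (lab-sym ax) ac xc ad ℕ.≤-refl cd t<cd xd)) a→c))
    ... | refl | same ax | above ad m = cyclic (lab-sym xc) (lab-sym ax) ac c→x
            (step (cmt₁ (cmt xb ba (lab-sym ax) bd bd≤ ad m xd)) b→a) a→c
    pull-step {c = c} {b} {a} (cmt₁ {b = y} {d = d} T) y→b (cyclic {t} cb ba ac c→b b→a a→c)
      with cmt-labs T
    ... | _ , _ , _ , cy , yb , cb′ , yd , yd≤ , bd , t<bd , cd
      with lab-unique cb′ cb | position y a t | position a d t
    ... | refl | below ya   | _ = ⊥-elim (asym b→a (head-rule yb ba ℕ.≤-refl ya y→b))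
    ... | refl | above ya m | _ = ⊥-elim (asym
            (head-rule cy ya (ℕ.<⇒≤ m) (lab-below (lab-sym ac) m) (cmt-rule T c→b))
            (head-rule ba (lab-sym ya) (ℕ.<⇒≤ m) (lab-below (lab-sym yb) m) b→a))
    ... | refl | same ya | below ad = ⊥-elim (asym b→a
            (step (cmt₁ (cmt (lab-sym ya) yb (lab-sym ba) yd yd≤ bd t<bd ad)) y→b))
    ... | refl | same ya | same ad = ⊥-elim (asym a→c
            (cmt-rule (cmt (lab-sym ac) (lab-sym ba) cb ad ℕ.≤-refl bd t<bd cd) c→b))
    ... | refl | same ya | above ad m = cyclic yb ba (lab-sym ya) y→b b→a
            (step (cmt₂ (cmt cy ya (lab-sym ac) yd yd≤ ad m cd)) a→c)

    pull-back : Star (Aug 𝒢) p (u , v) → p ∈ O → Cyclic u v w → Cyclic (proj₁ p) (proj₂ p) w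
    pull-back ε       _ C = C
    pull-back (s ◅ r) o C = pull-step s o (pull-back r (step s o) C)

    -- A path from (v , u) to (u , v) would lie in O entirely, as is seen from its end backwards;
    -- but its start is the reverse of u → v.
    cyclic-not-Ness : Total O → Cyclic u v w → (u , v) ∉ Ness 𝒢
    cyclic-not-Ness {u} {v} {w} total C (_ , _ , _ , r) = asym (Cyclic.u→v C) (on-path ε r)
      where
      -- If instead (y , x) ∈ O, then the skew-symmetric path carries the
      -- triangle to (y , x), while r carries it to q; as (x , y) and q share
      -- an end, w would be joined to that end in both directions.
      on-path : Star (Aug 𝒢) (v , u) p → Star (Aug 𝒢) p (u , v) → p ∈ O
      on-path _ ε = Cyclic.u→v C
      on-path {x , y} pre (_◅_ {j = q} s r) with on-path (pre ◅◅ (s ◅ ε)) r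
      ... | q∈O with total (star-target (flip (proj₁ (Cyclic.uv C))) pre)
      ...   | inj₁ o = o
      ...   | inj₂ o with pull-back (swap-star pre) o C | pull-back r q∈O C | aug-shared s
      ...     | C₁ | C₂ | inj₁ refl = ⊥-elim (asym (Cyclic.v→w C₁) (Cyclic.w→u C₂))
      ...     | C₁ | C₂ | inj₂ refl = ⊥-elim (asym (Cyclic.w→u C₁) (Cyclic.v→w C₂))

    noCyclic⇒TTO : Total O → (∀ {u v w} → ¬ Cyclic u v w) → IsTTO 𝒢 O
    noCyclic⇒TTO total acyclic = orientation , transitive
      where
      orientation : IsOrientation 𝒢 O
      orientation = (⊆AP , λ { _ (o , o′) → asym o o′ })
                  , [ ⊆AP , flip ∘ ⊆AP ]′ , total
      transitive : ∀ {a b c} (ab : Edge a b) (bc : Edge b c) → (a , b) ∈ O → (b , c) ∈ O →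
        label a b ab ≤ label b c bc → Σ[ ac ∈ Edge a c ] (a , c) ∈ O × label b c bc ≤ label a c ac
      transitive {a} {b} {c} ab bc a→b b→c l with position a c (label b c bc)
      ... | below ac = ⊥-elim (asym b→c (head-rule (ab , refl) (bc , refl) l ac a→b))
      ... | above (ac , refl) m = ac , a→c (total ac) , ℕ.<⇒≤ m
        where
        a→c : (a , c) ∈ O ⊎ (c , a) ∈ O → (a , c) ∈ O
        a→c (inj₁ o) = o
        a→c (inj₂ _) = head-rule (bc , refl) (flip ac , sym (label-sym a c ac)) (ℕ.<⇒≤ m)
          (lab-below (lab-sym (ab , refl)) (ℕ.≤-<-trans l m)) b→c
      ... | same (ac , e) = ac , a→c (total ac) (ℕ.m≤n⇒m<n∨m≡n l) , ℕ.≤-reflexive (sym e)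
        where
        a→c : (a , c) ∈ O ⊎ (c , a) ∈ O → label a b ab < label b c bc ⊎ label a b ab ≡ label b c bc →
              (a , c) ∈ O
        a→c (inj₁ o) _ = o
        a→c (inj₂ _) (inj₁ m) = head-rule (bc , refl) (lab-sym (ac , e)) ℕ.≤-refl
          (lab-below (lab-sym (ab , refl)) m) b→c
        a→c (inj₂ o) (inj₂ m) = ⊥-elim (acyclic (cyclic (ab , m) (bc , refl) (lab-sym (ac , e)) a→b b→c o))

  -- Greedy construction of a TTO

  Consistent : Set
  Consistent = ∀ {u v} → (u , v) ∈ Ness 𝒢 → (v , u) ∉ Ness 𝒢

  -- The inequality compares the tail of the forcing arc with the head of the forced one:
  -- transporting a cyclic triangle along the arc that enters its first vertex u then yields one
  -- whose first vertex is no later than u.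
  Source : ArcSet 𝒢 → Fin n × Fin n → Set
  Source O (w , u) = (w , u) ∈ Ness 𝒢 ⊎
    (∃₂ λ x y → (x , y) ∈ O × Star (Aug 𝒢) (x , y) (w , u) × toℕ x ≤ toℕ u)

  sources-TTO : ∀ {O} → Closed O → Total O → (∀ {p} → p ∈ O → Source O p) → IsTTO 𝒢 O
  sources-TTO {O} closed total source = noCyclic⇒TTO closed total (λ C → least (<-wellFounded _) C)
    where
    open Closed closed
    least : Acc _<_ (toℕ u) → ¬ Cyclic closed u v w
    least (acc rs) C with source (Cyclic.w→u C)
    ... | inj₁ ness = cyclic-not-Ness closed total (rotate closed C) ness
    ... | inj₂ (x , y , o , r , x≤u) with pull-back closed r o (rotate closed C) | ℕ.m≤n⇒m<n∨m≡n x≤u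
    ...   | C′ | inj₁ x<u = least (rs x<u) C′
    ...   | C′ | inj₂ x≡u with toℕ-injective x≡u
    ...     | refl = asym (Cyclic.u→v C) (Cyclic.w→u C′)

  source-⊆ : ∀ {O O′ : ArcSet 𝒢} → O ⊆ O′ → Source O p → Source O′ p
  source-⊆ O⊆O′ = Sum.map₂ (λ { (x , y , o , rest) → x , y , O⊆O′ o , rest })

  record Stage (k : ℕ) (O : ArcSet 𝒢) : Set where
    field
      closed  : Closed O
      member? : U.Decidable O
      source  : p ∈ O → Source O p
      decided : Edge u v → toℕ u < k → (u , v) ∈ O ⊎ (v , u) ∈ O

  empty-stage : Stage 0 U.∅
  empty-stage = record
    { closed  = record { ⊆AP = λ () ; asym = λ () ; step = λ _ () }
    ; member? = λ _ → no (λ ())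
    ; source  = λ ()
    ; decided = λ _ () }

  -- By skew-symmetry, a clash between an old and a new arc would put `swap p` into O, and a clash
  -- between two new arcs would give a path from p to `swap p`.
  extend : ∀ {O} → Stage k O → p ∈ AP 𝒢 → swap p ∉ O → ¬ Star (Aug 𝒢) p (swap p) →
           (∀ {q} → Star (Aug 𝒢) p q → q ∈ O ⊎ Source (O ∪ Star (Aug 𝒢) p) q) →
           Stage k (O ∪ Star (Aug 𝒢) p)
  extend {p = p} {O} S e p∉ ¬r new = record
    { closed = record
      { ⊆AP  = [ ⊆AP , star-target e ]′
      ; asym = asym′
      ; step = λ s → Sum.map (step s) (λ r → r ◅◅ (s ◅ ε)) }
    ; member? = λ q → member? q ⊎-dec aug-star? p q
    ; source  = [ source-⊆ inj₁ ∘ source , [ source-⊆ inj₁ ∘ source , id ]′ ∘ new ]′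
    ; decided = λ uv u<k → Sum.map inj₁ inj₁ (decided uv u<k) }
    where
    open Stage S
    open Closed closed
    asym′ : (u , v) ∈ O ∪ Star (Aug 𝒢) p → (v , u) ∉ O ∪ Star (Aug 𝒢) p
    asym′ (inj₁ o) (inj₁ o′) = asym o o′
    asym′ (inj₁ o) (inj₂ r)  = p∉ (steps (swap-star r) o)
    asym′ (inj₂ r) (inj₁ o)  = p∉ (steps (swap-star r) o)
    asym′ (inj₂ r) (inj₂ r′) = ¬r (r ◅◅ swap-star r′)

  module _ (consistent : Consistent) where

    decide-pair : ∀ x y {O} → Stage (toℕ x) O →
      Σ[ O′ ∈ ArcSet 𝒢 ] Stage (toℕ x) O′ × O ⊆ O′ × (Edge x y → (x , y) ∈ O′ ⊎ (y , x) ∈ O′)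
    decide-pair x y {O} S with edge? x y
    ... | no ¬e = O , S , id , λ e → ⊥-elim (¬e e)
    ... | yes e with Stage.member? S (x , y) | Stage.member? S (y , x) | aug-star? (x , y) (y , x)
    ...   | yes o | _ | _ = O , S , id , λ _ → inj₁ o
    ...   | no _ | yes o | _ = O , S , id , λ _ → inj₂ o
    ...   | no xy∉ | no yx∉ | no ¬r = _ , extend S e yx∉ ¬r new , inj₁ , λ _ → inj₁ (inj₂ ε)
      where
      open Stage S
      new : Star (Aug 𝒢) (x , y) q → q ∈ O ⊎ Source (O ∪ Star (Aug 𝒢) (x , y)) q
      new {w , u} r with ℕ.≤-<-connex (toℕ x) (toℕ u)
      ... | inj₁ x≤u = inj₂ (inj₂ (x , y , inj₂ ε , r , x≤u))
      -- This edge has been decided in an earlier row. Had it become (u , w), then (y , x) would be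
      -- in O by contraposition; so (w , u) is an old arc.
      ... | inj₂ u<x with decided (flip (star-target e r)) u<x
      ...   | inj₁ o = ⊥-elim (yx∉ (Closed.steps closed (swap-star r) o))
      ...   | inj₂ o = inj₁ o
    ...   | no xy∉ | no yx∉ | yes r =
      _ , extend S (flip e) xy∉ ¬r new , inj₁ , λ _ → inj₂ (inj₂ ε)
      where
      ¬r : ¬ Star (Aug 𝒢) (y , x) (x , y)
      ¬r r′ = consistent (e , flip e , e , r′) (flip e , e , flip e , r)
      new : Star (Aug 𝒢) (y , x) q → q ∈ O ⊎ Source (O ∪ Star (Aug 𝒢) (y , x)) q
      -- Now (y , x) is necessary, and so is every q that it forces: the path runs from `swap q`
      -- through (x , y) and (y , x) to q.
      new r′ = inj₂ (inj₁ (yx , flip yx , yx , swap-star r′ ◅◅ r ◅◅ r′))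
        where yx = star-target (flip e) r′

    decide-row : ∀ x ys {O} → Stage (toℕ x) O →
      Σ[ O′ ∈ ArcSet 𝒢 ] Stage (toℕ x) O′ × O ⊆ O′ ×
        (∀ {y} → y ∈ˡ ys → Edge x y → (x , y) ∈ O′ ⊎ (y , x) ∈ O′)
    decide-row x [] S = _ , S , id , λ ()
    decide-row x (y ∷ ys) S with decide-pair x y S
    ... | _ , S₁ , O⊆O₁ , d₁ with decide-row x ys S₁
    ...   | O₂ , S₂ , O₁⊆O₂ , d₂ = O₂ , S₂ , O₁⊆O₂ ∘ O⊆O₁ , λ
      { (here refl) → Sum.map O₁⊆O₂ O₁⊆O₂ ∘ d₁ ; (there i) → d₂ i }

    stage : ∀ k → k ≤ n → ∃ (Stage k)
    stage zero    _   = U.∅ , empty-stage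
    stage (suc k) k<n with stage k (ℕ.<⇒≤ k<n)
    ... | O , S with decide-row (fromℕ< k<n) (allFin n) (subst (λ j → Stage j O) (sym (toℕ-fromℕ< k<n)) S)
    ...   | O′ , S′ , _ , d = O′ , record
      { closed  = closed ; member? = member? ; source = source ; decided = decided′ }
      where
      open Stage S′
      decided′ : Edge u v → toℕ u < suc k → (u , v) ∈ O′ ⊎ (v , u) ∈ O′
      decided′ {u} uv u≤k with ℕ.m≤n⇒m<n∨m≡n (s≤s⁻¹ u≤k)
      ... | inj₁ u<k = decided uv (subst (toℕ u <_) (sym (toℕ-fromℕ< k<n)) u<k)
      ... | inj₂ u≡k with toℕ-injective (trans u≡k (sym (toℕ-fromℕ< k<n)))
      ...   | refl = d (∈-allFin _) uv

    consistent⇒TTO : AdmitsTTO 𝒢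
    consistent⇒TTO with stage n ℕ.≤-refl
    ... | O , S = O , sources-TTO closed (λ uv → decided uv (toℕ<n _)) source
      where open Stage S

  -- Consistency from an ATTO and from acyclicity

  module Orientation {O : ArcSet 𝒢} (orientation : IsOrientation 𝒢 O) where

    ⊆AP : O ⊆ AP 𝒢
    ⊆AP = proj₁ (proj₁ orientation)

    asym : (u , v) ∈ O → (v , u) ∉ O
    asym o o′ = proj₂ (proj₁ orientation) _ (o , o′)

    total : Total O
    total = proj₂ (proj₂ orientation)

    Ness⊆ : _⁺ 𝒢 O ⊆ O → Ness 𝒢 ⊆ O
    Ness⊆ O⁺⊆O (e , F) = [ id , (λ o → O⁺⊆O (_ , o , F)) ]′ (total e)

  ATTO⇒consistent : ∀ {O} → IsATTO 𝒢 O → Consistent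
  ATTO⇒consistent (orientation , O⁺⊆O , _) s r = asym (Ness⊆ O⁺⊆O s) (Ness⊆ O⁺⊆O r)
    where open Orientation orientation

  acyclic⇒consistent : NessAcyclic 𝒢 → Consistent
  acyclic⇒consistent acyclic {u} {v} s@(e , _) r =
    acyclic (u , v ∷ [] , ((edge-≢ e ∷ []) ∷ [] ∷ []) , s ∷ r ∷ [-])

  -- TTOs are closed under forcing and acyclic on necessary arcs

  module _ {O : ArcSet 𝒢} (tto : IsTTO 𝒢 O) where
    open Orientation (proj₁ tto)

    shortcut : (a , b) ∈ O → Lab a b i → (b , c) ∈ O → Lab b c j → i ≤ j →
               ∃ λ k → (a , c) ∈ O × Lab a c k × j ≤ k
    shortcut o (ab , refl) o′ (bc , refl) l with proj₂ tto ab bc o o′ l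
    ... | ac , o″ , m = _ , o″ , (ac , refl) , m

    no-path : Lab a b i → Lab b c j → i ≤ j → Below a c j → (a , b) ∈ O → (b , c) ∉ O
    no-path ab bc l ac o o′ with shortcut o ab o′ bc l
    ... | _ , _ , (e , refl) , m = ℕ.<⇒≱ (ac e) m

    -- Transitivity would add b → a. Whatever the directions of cd and bd, one of b → c → d, b → d →
    -- c, d → b → a is then a directed path whose shortcut is missing or too early.
    no-cmt : CorrelatedMonolabelTriangle 𝒢 a b c d → (b , c) ∈ O → (c , a) ∉ O
    no-cmt T b→c c→a with cmt-labs T
    ... | _ , _ , _ , ab , bc , ac , bd , bd≤ , cd , t<cd , ad
      with total (proj₁ cd) | total (proj₁ bd) | shortcut b→c bc c→a (lab-sym ac) ℕ.≤-refl
    ...   | inj₁ c→d | _ | _ = no-path bc cd (ℕ.<⇒≤ t<cd) (lab-below bd (ℕ.≤-<-trans bd≤ t<cd)) b→c c→d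
    ...   | inj₂ d→c | inj₁ b→d | _ =
      no-path bd (lab-sym cd) (ℕ.≤-trans bd≤ (ℕ.<⇒≤ t<cd)) (lab-below bc t<cd) b→d d→c
    ...   | inj₂ d→c | inj₂ d→b | _ , b→a , _ =
      no-path (lab-sym bd) (lab-sym ab) bd≤ (below-sym ad) d→b b→a

    TTO-closed : Closed O
    TTO-closed = record
      { ⊆AP  = ⊆AP
      ; asym = asym
      ; step = step }
      where
      reverse-unless : Edge u v → (v , u) ∉ O → (u , v) ∈ O
      reverse-unless e ¬o = [ id , ⊥-elim ∘ ¬o ]′ (total e)
      step : Aug 𝒢 p q → p ∈ O → q ∈ O
      step s@(imp (head T)) o with impTriple-below T
      ... | _ , _ , ab , bc , l , ac = reverse-unless (aug-target s) (no-path ab bc l ac o)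
      step s@(imp (tail T)) o with impTriple-below T
      ... | _ , _ , ab , bc , l , ac = reverse-unless (aug-target s) (λ o′ → no-path ab bc l ac o′ o)
      step s@(cmt₁ T) o = reverse-unless (aug-target s) (no-cmt T o)
      step s@(cmt₂ T) o = reverse-unless (aug-target s) (λ o′ → no-cmt T o′ o)

    TTO-forced : _⁺ 𝒢 O ⊆ O
    TTO-forced (_ , o , _ , _ , r) = Closed.steps TTO-closed r o

    TTO⇒ATTO : IsATTO 𝒢 O
    TTO⇒ATTO = proj₁ tto , TTO-forced , λ o → _ , o , ⊆AP o , ⊆AP o , ε

    -- Label-decreasing walks, indexed by their first label.  Every walk
    -- shortens to one: an arc that breaks the descent in front composes with
    -- the first arc to a single arc with no smaller label.
    data Descent : Fin n → Fin n → ℕ → Set where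
      [_]    : (u , v) ∈ O × Lab u v k → Descent u v k
      _∷⟨_⟩_ : (u , v) ∈ O × Lab u v k → j < k → Descent v w j → Descent u w k

    push : (u , v) ∈ O × Lab u v k → Descent v w j → ∃ (Descent u w)
    push {k = k} {j = j} a@(o , l) D with ℕ.≤-<-connex k j | D
    ... | inj₂ j<k | _ = _ , a ∷⟨ j<k ⟩ D
    ... | inj₁ k≤j | [ o′ , l′ ] with shortcut o l o′ l′ k≤j
    ...   | _ , o″ , l″ , _ = _ , [ o″ , l″ ]
    push a@(o , l) _ | inj₁ k≤j | (o′ , l′) ∷⟨ m ⟩ D with shortcut o l o′ l′ k≤j
    ...   | _ , o″ , l″ , j≤ = _ , (o″ , l″) ∷⟨ ℕ.<-≤-trans m j≤ ⟩ D

    -- Composition starts at the far end of the walk. Every composite has label at least j, hence at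
    -- least that of each arc of the walk, so the preceding arc can be composed with it in turn.
    absorb : Descent u v k → (v , w) ∈ O → Lab v w j → k ≤ j → ∃ λ i → (u , w) ∈ O × Lab u w i × j ≤ i
    absorb [ o , l ] o′ l′ m = shortcut o l o′ l′ m
    absorb ((o , l) ∷⟨ j<k ⟩ D) o′ l′ m with absorb D o′ l′ (ℕ.≤-trans (ℕ.<⇒≤ j<k) m)
    ... | _ , o″ , l″ , j≤i with shortcut o l o″ l″ (ℕ.≤-trans m j≤i)
    ...   | _ , o‴ , l‴ , i≤ = _ , o‴ , l‴ , ℕ.≤-trans j≤i i≤

    -- A closing arc with label at least k absorbs the whole walk into a loop at u. An earlier one
    -- composes with the first arc of the walk into a closing arc for the rest, which is shorter.
    not-closed : Descent u v k → (v , u) ∈ O → Lab v u j → ⊥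
    not-closed {k = k} {j = j} D o l with ℕ.≤-<-connex k j | D
    ... | inj₁ k≤j | _ with absorb D o l k≤j
    ...   | _ , o′ , _ = asym o′ o′
    not-closed D o l | inj₂ j<k | [ o′ , _ ] = asym o o′
    not-closed D o l | inj₂ j<k | (o′ , l′) ∷⟨ _ ⟩ D′ with shortcut o l o′ l′ (ℕ.<⇒≤ j<k)
    ...   | _ , o″ , l″ , _ = not-closed D′ o″ l″

    descent : ∀ {D : Rel (Fin n) 0ℓ} → (∀ {u v} → D u v → (u , v) ∈ O) →
              ∀ vs → Linked D ((u ∷ vs) ∷ʳ w) → ∃ (Descent u w)
    descent ⊆O []       (d ∷ [-]) = _ , [ ⊆O d , ⊆AP (⊆O d) , refl ]
    descent ⊆O (v ∷ vs) (d ∷ ds)  = push (⊆O d , ⊆AP (⊆O d) , refl) (proj₂ (descent ⊆O vs ds))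

    TTO⇒acyclic : NessAcyclic 𝒢
    TTO⇒acyclic (v , vs , _ , ds)
      with descent (Ness⊆ TTO-forced) vs ds
    ... | _ , [ o , _ ]        = asym o o
    -- The first arc of the closed walk serves as the closing arc of the remainder.
    ... | _ , (o , l) ∷⟨ _ ⟩ D = not-closed D o l

theorem2 : (n : ℕ) (𝒢 : TemporalGraph n) →
    (AdmitsTTO 𝒢 ⇔ AdmitsATTO 𝒢) × (AdmitsATTO 𝒢 ⇔ NessAcyclic 𝒢)
theorem2 n 𝒢 = mk⇔ tto⇒atto atto⇒tto
             , mk⇔ (λ A → TTO⇒acyclic 𝒢 (proj₂ (atto⇒tto A)))
                   (tto⇒atto ∘ consistent⇒TTO 𝒢 ∘ acyclic⇒consistent 𝒢)
  where
  tto⇒atto : AdmitsTTO 𝒢 → AdmitsATTO 𝒢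
  tto⇒atto (O , tto) = O , TTO⇒ATTO 𝒢 tto
  atto⇒tto : AdmitsATTO 𝒢 → AdmitsTTO 𝒢
  atto⇒tto (_ , atto) = consistent⇒TTO 𝒢 (ATTO⇒consistent 𝒢 atto)
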